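{- For every integer $n\ge 4$, the derangement graph $\Gamma_n$ is edge pancyclic: for every edge $e$ of $\Gamma_n$ and every integer $\ell$ with $3\le \ell\le n!$, there is a cycle of length $\ell$ in $\Gamma_n$ containing $e$.
   Context: Let $S_n$ be the symmetric group on $[n]=\{1,\ldots,n\}$. A derangement is a permutation with no fixed points; $D_n$ denotes the set of derangements in $S_n$. The derangement graph $\Gamma_n$ is the Cayley graph $\Gamma(S_n,D_n)$: its vertices are the $n!$ permutations in $S_n$, and two permutations $g,h$ are adjacent if and only if $g(i)\ne h(i)$ for all $i\in[n]$ (equivalently, $h^{ -1}g$ has no fixed point). A graph on $N\ge 3$ vertices is edge pancyclic if every edge lies on a cycle of each length from $3$ to $N$. -}

module Defs where

open import Data.Nat using (ℕ; zero; suc)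
open import Data.Fin using (Fin; zero; suc; toℕ)
open import Data.Fin.Permutation using (Permutation′; _⟨$⟩ʳ_; _≈_)
open import Data.Product using (_×_; ∃-syntax; Σ)
open import Data.Sum using (_⊎_)
open import Relation.Nullary using (¬_)
open import Relation.Binary.PropositionalEquality using (_≡_; _≢_)

-- Vertices of Γ_n: the permutations of Fin n (= S_n), identified up to
-- the library's extensional equality _≈_ (equal as functions).

-- Adjacency in the derangement graph Γ_n = Cay(S_n, D_n):
-- g ~ h  iff  g(i) ≠ h(i) for all i.
Adjacent : ∀ {n} → Permutation′ n → Permutation′ n → Set
Adjacent g h = ∀ i → g ⟨$⟩ʳ i ≢ h ⟨$⟩ʳ i

next : ∀ {k} → Fin k → Fin k
next {suc zero}    zero    = zero
next {suc (suc k)} zero    = suc zero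
next {suc (suc k)} (suc i) with next {suc k} i
... | zero   = zero
... | suc j  = suc (suc j)

record Cycle (n ℓ : ℕ) : Set where
  field
    vertex   : Fin ℓ → Permutation′ n
    distinct : ∀ i j → vertex i ≈ vertex j → i ≡ j
    adjacent : ∀ i → Adjacent (vertex i) (vertex (next i))

ContainsEdge : ∀ {n ℓ} → Cycle n ℓ → Permutation′ n → Permutation′ n → Set
ContainsEdge C g h =
  ∃[ i ] ((vertex i ≈ g × vertex (next i) ≈ h) ⊎ (vertex i ≈ h × vertex (next i) ≈ g))
  where open Cycle C

{-# OPTIONS --safe #-}

-- Let C be the group of rotations v ↦ a + v of the values in ℤ/n.  Each coset
-- C p is an n-clique of Γ_n.  If q = p ∘ τ for a transposition τ, then p x - q x
-- takes at most three values, so for n ≥ 4 some d is not among them, and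
-- a + p ↔ (a + d) + q is a perfect matching between the cliques C p and C q.
--
-- The (n-1)! cosets, represented by the permutations with a prescribed value
-- at 0, can be listed so that neighbours in the list differ by a transposition.
-- By induction along such a list, any two vertices a, b of the first clique are
-- joined by paths with any number of vertices from 2 up to the size of the union:
-- go from a to its partner in the second clique, follow a path through the
-- remaining cliques to the partner of some c, and walk from c to b in the first one.
--
-- For an edge g h, list the cosets starting from C g.  If h ∈ C g we are done.
-- Otherwise cut the list just before C h; the edge between 1 + g and 1 + h joins
-- a path from g to 1 + g in the first part to a path from 1 + h to h in the second.
-- Only the triangles remain; a common neighbour of g and h is found by repairing
-- an arbitrary permutation by transpositions, one position after another.
module Submission where

open import Defs
open import Data.Fin using (Fin; zero; suc; toℕ)
open import Data.Fin.Permutation using (Permutation′; permutation; transpose; _⟨$⟩ʳ_; _⟨$⟩ˡ_; _∘ₚ_; _≈_; inverseˡ; inverseʳ)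
open import Data.Fin.Properties using (_≟_; any?; pigeonhole; toℕ-fromℕ<; toℕ-injective; toℕ<n; toℕ≤n; suc-injective; <⇒≢)
open import Data.List using (List; []; _∷_; _++_; length; lookup; map; allFin; tabulate)
import Data.List.Membership.DecPropositional as DecMembership
open import Data.List.Membership.Propositional using (_∈_; _∉_)
open import Data.List.Membership.Propositional.Properties using (∈-allFin; ∈-lookup; ∈-map⁺; ∈-map⁻; ∈-tabulate⁺; ∈-tabulate⁻)
open import Data.List.Properties using (length-++; length-map; length-tabulate)
open import Data.List.Relation.Unary.All as All using (All; []; _∷_)
import Data.List.Relation.Unary.All.Properties as All
open import Data.List.Relation.Unary.AllPairs as AllPairs using (AllPairs; []; _∷_)
import Data.List.Relation.Unary.AllPairs.Properties as AllPairs
open import Data.List.Relation.Unary.Any as Any using (Any; here; there)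
import Data.List.Relation.Unary.Any.Properties as Any
open import Data.List.Relation.Unary.Unique.Propositional using (Unique)
import Data.List.Relation.Unary.Unique.Propositional.Properties as Unique
open import Data.Nat using (ℕ; zero; suc; _+_; _*_; _∸_; _≤_; _<_; _!; z≤n; s≤s; _≤?_)
open import Data.Nat.DivMod using (_%_; _mod_; m%n<n; m%n%n≡m%n; m<n⇒m%n≡m; n%n≡0; %-distribˡ-+)
open import Data.Nat.Properties hiding (_≟_; _≤?_; suc-injective; <⇒≢)
open import Data.Product using (Σ; ∃; ∃₂; _×_; _,_; proj₁; proj₂; swap)
open import Data.Sum using (_⊎_; inj₁; inj₂; [_,_]′)
open import Function using (_∘_)
open import Relation.Binary.PropositionalEquality using (_≡_; _≢_; refl; sym; trans; cong; cong₂; subst; module ≡-Reasoning)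
open import Relation.Nullary using (¬_; yes; no; contradiction; ¬?)
open import Relation.Nullary.Decidable using (decidable-stable)

private
  module _ {n : ℕ} where
    open DecMembership (_≟_ {n}) public using (_∈?_)

-- Chains: walks stored as lists, and the cyclic successor on their indices.

-- Chain R u v xs: consecutive entries of u ∷ xs are related by R, and the last one is v.
data Chain {A : Set} (R : A → A → Set) : A → A → List A → Set where
  [-] : ∀ {u} → Chain R u u []
  _∷_ : ∀ {u v w xs} → R u v → Chain R v w xs → Chain R u w (v ∷ xs)

module _ {A : Set} {R : A → A → Set} where

  chain-++ : ∀ {u v w z xs ys} → Chain R u v xs → R v w → Chain R w z ys → Chain R u z (xs ++ w ∷ ys)
  chain-++ [-]     r d = r ∷ d
  chain-++ (s ∷ c) r d = s ∷ chain-++ c r d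

  chain-map : ∀ {B : Set} {S : B → B → Set} {f : A → B} → (∀ {u v} → R u v → S (f u) (f v)) →
              ∀ {u v xs} → Chain R u v xs → Chain S (f u) (f v) (map f xs)
  chain-map h [-]     = [-]
  chain-map h (r ∷ c) = h r ∷ chain-map h c

  last∈chain : ∀ {u v xs} → Chain R u v xs → v ∈ u ∷ xs
  last∈chain [-]     = here refl
  last∈chain (_ ∷ c) = there (last∈chain c)

  -- The cut falls strictly after `u`, so both pieces, `u ∷ before` and `start ∷ after`, are
  -- nonempty.
  record Split (P : A → Set) (u v : A) (xs : List A) : Set where
    field
      {mid start} : A
      {before after} : List A
      beforeChain : Chain R u mid before
      afterChain  : Chain R start v after
      start-P     : P start
      ++-eq       : xs ≡ before ++ start ∷ after

  chain-split : ∀ {P : A → Set} {u v xs} → Chain R u v xs → Any P xs → Split P u v xs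
  chain-split (r ∷ c) (here p)  = record
    { beforeChain = [-] ; afterChain = c ; start-P = p ; ++-eq = refl }
  chain-split (r ∷ c) (there p) = record
    { beforeChain = r ∷ beforeChain ; afterChain = afterChain
    ; start-P = start-P ; ++-eq = cong (_ ∷_) ++-eq }
    where open Split (chain-split c p)

  chain-next : ∀ {u v xs} → R v u → Chain R u v xs →
               ∀ i → R (lookup (u ∷ xs) i) (lookup (u ∷ xs) (next i))
  chain-next {u} {v} vRu c i with next i | successor c i
    where
    -- `next` returns `zero` only at the last index, where the entry must be `v`; everywhere else it
    -- points to the following entry of the chain.
    Successor : (xs : List A) → A → Fin (suc (length xs)) → Fin (suc (length xs)) → Set
    Successor xs u i zero    = lookup (u ∷ xs) i ≡ v
    Successor xs u i (suc j) = R (lookup (u ∷ xs) i) (lookup xs j)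

    successor : ∀ {u xs} → Chain R u v xs → ∀ i → Successor xs u i (next i)
    successor [-]     zero    = refl
    successor (r ∷ c) zero    = r
    successor (r ∷ c) (suc i) with next i | successor c i
    ... | zero  | eq = eq
    ... | suc j | s  = s
  ... | zero  | eq = subst (λ w → R w u) (sym eq) vRu
  ... | suc j | s  = s

  chain-last : ∀ {u v xs} → Chain R u v xs → ∃ λ i → next i ≡ zero × lookup (u ∷ xs) i ≡ v
  chain-last [-]     = zero , refl , refl
  chain-last (r ∷ c) with chain-last c
  ... | i , eq , eq′ = suc i , next-suc eq , eq′
    where
    next-suc : ∀ {k} {i : Fin (suc k)} → next i ≡ zero → next (suc i) ≡ zero
    next-suc {i = i} eq with next i | eq
    ... | zero | refl = refl

AllPairs-++⁻ : ∀ {A : Set} {R : A → A → Set} (xs : List A) {ys} → AllPairs R (xs ++ ys) →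
               AllPairs R xs × AllPairs R ys × All (λ x → All (R x) ys) xs
AllPairs-++⁻ []       p       = [] , p , []
AllPairs-++⁻ (x ∷ xs) (r ∷ p) =
  let q , s , t = AllPairs-++⁻ xs p in All.++⁻ˡ xs r ∷ q , s , All.++⁻ʳ xs r ∷ t

-- Permutations and transpositions.

module _ {n : ℕ} where

  private
    Perm : Set
    Perm = Permutation′ n

  ⟨$⟩ʳ-injective : (p : Perm) → ∀ {x y} → p ⟨$⟩ʳ x ≡ p ⟨$⟩ʳ y → x ≡ y
  ⟨$⟩ʳ-injective p eq = trans (sym (inverseˡ p)) (trans (cong (p ⟨$⟩ˡ_) eq) (inverseˡ p))

  ⟨$⟩ʳ⇒⟨$⟩ˡ : (p : Perm) → ∀ {x y} → p ⟨$⟩ʳ x ≡ y → x ≡ p ⟨$⟩ˡ y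
  ⟨$⟩ʳ⇒⟨$⟩ˡ p refl = sym (inverseˡ p)

  transpose-matchˡ : (i j : Fin n) → transpose i j ⟨$⟩ʳ i ≡ j
  transpose-matchˡ i j with i ≟ i
  ... | yes _  = refl
  ... | no i≢i = contradiction refl i≢i

  transpose-cases : (i j k : Fin n) → (k ≡ i × transpose i j ⟨$⟩ʳ k ≡ j) ⊎
                    (k ≡ j × transpose i j ⟨$⟩ʳ k ≡ i) ⊎ transpose i j ⟨$⟩ʳ k ≡ k
  transpose-cases i j k with k ≟ i
  ... | yes eq = inj₁ (eq , refl)
  ... | no  _  with k ≟ j
  ...   | yes eq = inj₂ (inj₁ (eq , refl))
  ...   | no  _  = inj₂ (inj₂ refl)

  -- If nothing were missing, sending each element to its index in `xs` would contradict the
  -- pigeonhole principle.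
  missing : (xs : List (Fin n)) → length xs < n → ∃ (_∉ xs)
  missing xs len with any? (λ d → ¬? (d ∈? xs))
  ... | yes p = p
  ... | no ¬p =
    let all∈ d = decidable-stable (d ∈? xs) (¬p ∘ (d ,_))
        i , j , i<j , eq = pigeonhole len (Any.index ∘ all∈)
    in contradiction
         (trans (Any.lookup-index (all∈ i)) (trans (cong (lookup xs) eq) (sym (Any.lookup-index (all∈ j)))))
         (<⇒≢ i<j)

  -- Listing permutations so that neighbours differ by a transposition.

  Swap : Perm → Perm → Set
  Swap p q = ∃₂ λ i j → q ≡ transpose i j ∘ₚ p

  -- `last` is recorded because joining two listings needs a swap from the end of one to the
  -- beginning of the other.
  record Enumeration (P : Perm → Set) (p : Perm) (size : ℕ) : Set where
    field
      {last}   : Perm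
      {rest}   : List Perm
      chain    : Chain Swap p last rest
      sound    : All P (p ∷ rest)
      complete : ∀ q → P q → Any (q ≈_) (p ∷ rest)
      distinct : AllPairs (λ q r → ¬ q ≈ r) (p ∷ rest)
      count    : length (p ∷ rest) ≡ size

  enumeration-cong : ∀ {P Q p m} → (∀ q → P q → Q q) → (∀ q → Q q → P q) →
                     Enumeration P p m → Enumeration Q p m
  enumeration-cong P⇒Q Q⇒P E = record
    { chain = chain ; sound = All.map (P⇒Q _) sound ; complete = λ q → complete q ∘ Q⇒P q
    ; distinct = distinct ; count = count }
    where open Enumeration E

  enumeration-++ : ∀ {P Q p q l m} (E : Enumeration P p l) → Swap (Enumeration.last E) q →
                   Enumeration Q q m → (∀ {r s} → P r → Q s → ¬ r ≈ s) →
                   Enumeration (λ r → P r ⊎ Q r) p (l + m)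
  enumeration-++ {p = p} E s F P#Q = record
    { chain    = chain-++ E.chain s F.chain
    ; sound    = All.++⁺ (All.map inj₁ E.sound) (All.map inj₂ F.sound)
    ; complete = λ r → [ Any.++⁺ˡ ∘ E.complete r , Any.++⁺ʳ (p ∷ E.rest) ∘ F.complete r ]′
    ; distinct = AllPairs.++⁺ E.distinct F.distinct (All.map (λ Pr → All.map (P#Q Pr) F.sound) E.sound)
    ; count    = trans (length-++ (p ∷ E.rest)) (cong₂ _+_ E.count F.count)
    }
    where module E = Enumeration E
          module F = Enumeration F

  -- For fixed `p` and `xs` this is the coset of `p` under permutations of the positions in `xs`.
  AgreeOff : List (Fin n) → Perm → Perm → Set
  AgreeOff xs p q = ∀ x → x ∉ xs → p ⟨$⟩ʳ x ≡ q ⟨$⟩ʳ x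

  module _ {x : Fin n} {xs : List (Fin n)} (x∉xs : x ∉ xs) {m : ℕ}
           (enumerateOff : ∀ r → Enumeration (AgreeOff xs r) r m) where

    inBlock : ∀ {r v ws} → r ⟨$⟩ʳ x ≡ v → ∀ q → AgreeOff xs r q →
              AgreeOff (x ∷ xs) r q × q ⟨$⟩ʳ x ∈ v ∷ ws
    inBlock rx≡v q agree = (λ y y∉ → agree y (y∉ ∘ there)) , here (trans (sym (agree x x∉xs)) rx≡v)

    block : ∀ {r v} → r ⟨$⟩ʳ x ≡ v → ∀ q → AgreeOff (x ∷ xs) r q → q ⟨$⟩ʳ x ≡ v → AgreeOff xs r q
    block rx≡v q agree qx≡v y y∉xs with y ≟ x
    ... | yes refl = trans rx≡v (sym qx≡v)
    ... | no  y≢x  = agree y λ { (here y≡x) → y≢x y≡x ; (there y∈) → y∉xs y∈ }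

    -- One block for each value at x; the last permutation of a block is turned into
    -- the first one of the next by moving the next value to x.
    enumerate-blocks : ∀ r v ws → r ⟨$⟩ʳ x ≡ v → Unique (v ∷ ws) →
                       (∀ {w} → w ∈ ws → ∀ y → y ∉ x ∷ xs → r ⟨$⟩ʳ y ≢ w) →
                       Enumeration (λ q → AgreeOff (x ∷ xs) r q × q ⟨$⟩ʳ x ∈ v ∷ ws) r (suc (length ws) * m)
    enumerate-blocks r v [] rx≡v _ _ = subst (Enumeration _ r) (sym (+-identityʳ m))
      (enumeration-cong (inBlock {r} rx≡v) (λ { q (agree , here eq) → block {r} rx≡v q agree eq }) (enumerateOff r))
    enumerate-blocks r v (w ∷ ws) rx≡v (v∉ ∷ unique) avoid =
      enumeration-cong
        (λ q → [ inBlock {r} rx≡v q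
               , (λ (agree , q∈) → (λ y y∉ → trans (r~r′ y y∉) (agree y y∉)) , there q∈) ]′)
        (λ { q (agree , here eq)  → inj₁ (block {r} rx≡v q agree eq)
           ; q (agree , there q∈) → inj₂ ((λ y y∉ → trans (sym (r~r′ y y∉)) (agree y y∉)) , q∈) })
        (enumeration-++ first (x , z , refl)
          (enumerate-blocks r′ w ws r′x≡w unique
            (λ w′∈ y y∉ r′y≡ → avoid (there w′∈) y y∉ (trans (r~r′ y y∉) r′y≡)))
          (λ agree (_ , q′∈) q≈q′ → All.lookup v∉ q′∈
            (trans (sym rx≡v) (trans (agree x x∉xs) (q≈q′ x)))))
      where
      first = enumerateOff r
      s  = Enumeration.last first
      z  = s ⟨$⟩ˡ w
      r′ = transpose x z ∘ₚ s

      r~s : AgreeOff xs r s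
      r~s = All.lookup (Enumeration.sound first) (last∈chain (Enumeration.chain first))

      r′x≡w : r′ ⟨$⟩ʳ x ≡ w
      r′x≡w = trans (cong (s ⟨$⟩ʳ_) (transpose-matchˡ x z)) (inverseʳ s)

      -- The swap stays within `x ∷ xs`: off this list `s` agrees with `r`, which by `avoid` does
      -- not take the value `w` there, so `z` is in the list.
      r~r′ : AgreeOff (x ∷ xs) r r′
      r~r′ y y∉ with transpose-cases x z y
      ... | inj₁ (y≡x , _)           = contradiction (here y≡x) y∉
      ... | inj₂ (inj₁ (y≡z , _))    = contradiction
        (trans (r~s y (y∉ ∘ there)) (trans (cong (s ⟨$⟩ʳ_) y≡z) (inverseʳ s)))
        (avoid (here refl) y y∉)
      ... | inj₂ (inj₂ eq)           = trans (r~s y (y∉ ∘ there)) (cong (s ⟨$⟩ʳ_) (sym eq))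

  -- Induction on `xs`, with one block for each possible value at `x`. These are the values of `p`
  -- on `x ∷ xs`; the value at `x` is put first so that the listing begins with `p`.
  enumerate : ∀ xs → Unique xs → ∀ p → Enumeration (AgreeOff xs p) p (length xs !)
  enumerate [] _ p = record
    { chain = [-] ; sound = (λ _ _ → refl) ∷ [] ; complete = λ q agree → here (λ x → sym (agree x λ ()))
    ; distinct = [] ∷ [] ; count = refl }
  enumerate (x ∷ xs) unique@(x∉xs ∷ xs!) p =
    enumeration-cong (λ _ → proj₁) (λ q agree → agree , value∈ q agree)
      (subst (λ l → Enumeration (λ q → AgreeOff (x ∷ xs) p q × q ⟨$⟩ʳ x ∈ map (p ⟨$⟩ʳ_) (x ∷ xs)) p (suc l * length xs !))
        (length-map (p ⟨$⟩ʳ_) xs)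
        (enumerate-blocks (Unique.Unique[x∷xs]⇒x∉xs unique) (enumerate xs xs!) p (p ⟨$⟩ʳ x) (map (p ⟨$⟩ʳ_) xs)
          refl (Unique.map⁺ (⟨$⟩ʳ-injective p) unique) avoid))
    where
    avoid : ∀ {w} → w ∈ map (p ⟨$⟩ʳ_) xs → ∀ y → y ∉ x ∷ xs → p ⟨$⟩ʳ y ≢ w
    avoid w∈ y y∉ py≡w with ∈-map⁻ (p ⟨$⟩ʳ_) w∈
    ... | z , z∈ , w≡pz = y∉ (there (subst (_∈ xs) (sym (⟨$⟩ʳ-injective p (trans py≡w w≡pz))) z∈))

    -- If `p` took the value of `q` at `x` at a position off the list, `q` would take it there as
    -- well, and injectivity would make that position `x`.
    value∈ : ∀ q → AgreeOff (x ∷ xs) p q → q ⟨$⟩ʳ x ∈ map (p ⟨$⟩ʳ_) (x ∷ xs)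
    value∈ q agree with p ⟨$⟩ˡ (q ⟨$⟩ʳ x) ∈? x ∷ xs
    ... | yes y∈ = subst (_∈ map (p ⟨$⟩ʳ_) (x ∷ xs)) (inverseʳ p) (∈-map⁺ (p ⟨$⟩ʳ_) y∈)
    ... | no  y∉ = contradiction
      (here (⟨$⟩ʳ-injective q (trans (sym (agree _ y∉)) (inverseʳ p)))) y∉

  -- Closing a chain to a cycle.

  -- The edge closes the chain from its last vertex back to its first, so it is found at the index
  -- that `next` sends to `zero`, in reversed orientation. The ends are given up to `≈` because the
  -- paths will start at `zero ▹ g`.
  cycle-of-chain : ∀ g h {u v xs ℓ} → Adjacent g h → u ≈ g → v ≈ h → Chain Adjacent u v xs →
                   AllPairs (λ p q → ¬ p ≈ q) (u ∷ xs) → length (u ∷ xs) ≡ ℓ →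
                   Σ (Cycle n ℓ) (λ C → ContainsEdge C g h)
  cycle-of-chain g h {u} {v} {xs} g~h u≈g v≈h chain distinct refl =
    record
      { vertex   = lookup (u ∷ xs)
      ; distinct = lookup-injective distinct
      ; adjacent = chain-next (λ i eq → g~h i (trans (sym (u≈g i)) (trans (sym eq) (v≈h i)))) chain
      }
    , let i , next≡0 , eq = chain-last chain
      in i , inj₂ ( (λ x → trans (cong (_⟨$⟩ʳ x) eq) (v≈h x))
                  , (λ x → trans (cong (λ j → lookup (u ∷ xs) j ⟨$⟩ʳ x) next≡0) (u≈g x)))
    where
    lookup-injective : ∀ {ps : List Perm} → AllPairs (λ p q → ¬ p ≈ q) ps →
                       ∀ i j → lookup ps i ≈ lookup ps j → i ≡ j
    lookup-injective (_ ∷ _)    zero    zero    _  = refl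
    lookup-injective (p≉ ∷ _)   zero    (suc j) eq = contradiction eq (All.lookup p≉ (∈-lookup j))
    lookup-injective (p≉ ∷ _)   (suc i) zero    eq = contradiction (λ x → sym (eq x)) (All.lookup p≉ (∈-lookup i))
    lookup-injective (_ ∷ ps!)  (suc i) (suc j) eq = cong suc (lookup-injective ps! i j eq)

-- The cyclic group of residues modulo `suc k`.

module _ {k : ℕ} where

  infixl 6 _⊕_

  abstract
    _⊕_ : Fin (suc k) → Fin (suc k) → Fin (suc k)
    a ⊕ b = (toℕ a + toℕ b) mod suc k

    ⊖_ : Fin (suc k) → Fin (suc k)
    ⊖ a = (suc k ∸ toℕ a) mod suc k

    [m%n+o]%n : ∀ m o → (m % suc k + o) % suc k ≡ (m + o) % suc k
    [m%n+o]%n m o = begin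
      (m % suc k + o) % suc k                     ≡⟨ %-distribˡ-+ (m % suc k) o (suc k) ⟩
      (m % suc k % suc k + o % suc k) % suc k     ≡⟨ cong (λ z → (z + o % suc k) % suc k) (m%n%n≡m%n m (suc k)) ⟩
      (m % suc k + o % suc k) % suc k             ≡⟨ %-distribˡ-+ m o (suc k) ⟨
      (m + o) % suc k                             ∎
      where open ≡-Reasoning

    -- Reducing the left summand early does no harm, so associativity and inverses can be checked on
    -- natural numbers.
    mod-⊕ : ∀ m a → m mod suc k ⊕ a ≡ (m + toℕ a) mod suc k
    mod-⊕ m a = toℕ-injective (begin
      toℕ (m mod suc k ⊕ a)                  ≡⟨ toℕ-fromℕ< _ ⟩
      (toℕ (m mod suc k) + toℕ a) % suc k    ≡⟨ cong (λ z → (z + toℕ a) % suc k) (toℕ-fromℕ< (m%n<n m (suc k))) ⟩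
      (m % suc k + toℕ a) % suc k            ≡⟨ [m%n+o]%n m (toℕ a) ⟩
      (m + toℕ a) % suc k                    ≡⟨ toℕ-fromℕ< _ ⟨
      toℕ ((m + toℕ a) mod suc k)            ∎)
      where open ≡-Reasoning

    ⊕-comm : ∀ a b → a ⊕ b ≡ b ⊕ a
    ⊕-comm a b = cong (_mod suc k) (+-comm (toℕ a) (toℕ b))

    ⊕-assoc : ∀ a b c → a ⊕ b ⊕ c ≡ a ⊕ (b ⊕ c)
    ⊕-assoc a b c = begin
      -- `mod-⊕` absorbs a reduction on the left only, so `b ⊕ c` is brought to the left of `a`.
      a ⊕ b ⊕ c                                ≡⟨ mod-⊕ (toℕ a + toℕ b) c ⟩
      (toℕ a + toℕ b + toℕ c) mod suc k        ≡⟨ cong (_mod suc k) (trans (+-assoc (toℕ a) _ _) (+-comm (toℕ a) _)) ⟩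
      (toℕ b + toℕ c + toℕ a) mod suc k        ≡⟨ mod-⊕ (toℕ b + toℕ c) a ⟨
      b ⊕ c ⊕ a                                ≡⟨ ⊕-comm (b ⊕ c) a ⟩
      a ⊕ (b ⊕ c)                              ∎
      where open ≡-Reasoning

    ⊕-identityˡ : ∀ a → zero ⊕ a ≡ a
    ⊕-identityˡ a = toℕ-injective (trans (toℕ-fromℕ< _) (m<n⇒m%n≡m (toℕ<n a)))

    ⊕-inverseˡ : ∀ a → ⊖ a ⊕ a ≡ zero
    ⊕-inverseˡ a = trans (mod-⊕ (suc k ∸ toℕ a) a) (toℕ-injective (begin
      toℕ ((suc k ∸ toℕ a + toℕ a) mod suc k)  ≡⟨ toℕ-fromℕ< _ ⟩
      (suc k ∸ toℕ a + toℕ a) % suc k          ≡⟨ cong (_% suc k) (m∸n+n≡m (toℕ≤n a)) ⟩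
      suc k % suc k                            ≡⟨ n%n≡0 (suc k) ⟩
      0                                        ∎))
      where open ≡-Reasoning

  ⊖a⊕[a⊕x]≡x : ∀ a x → ⊖ a ⊕ (a ⊕ x) ≡ x
  ⊖a⊕[a⊕x]≡x a x = trans (sym (⊕-assoc (⊖ a) a x)) (trans (cong (_⊕ x) (⊕-inverseˡ a)) (⊕-identityˡ x))

  a⊕[⊖a⊕x]≡x : ∀ a x → a ⊕ (⊖ a ⊕ x) ≡ x
  a⊕[⊖a⊕x]≡x a x = trans (sym (⊕-assoc a (⊖ a) x))
    (trans (cong (_⊕ x) (trans (⊕-comm a (⊖ a)) (⊕-inverseˡ a))) (⊕-identityˡ x))

  x⊕⊖a⊕a≡x : ∀ a x → x ⊕ ⊖ a ⊕ a ≡ x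
  x⊕⊖a⊕a≡x a x = trans (⊕-assoc x (⊖ a) a)
    (trans (cong (x ⊕_) (⊕-inverseˡ a)) (trans (⊕-comm x zero) (⊕-identityˡ x)))

  ⊕-cancelˡ : ∀ a {x y} → a ⊕ x ≡ a ⊕ y → x ≡ y
  ⊕-cancelˡ a {x} {y} eq = trans (sym (⊖a⊕[a⊕x]≡x a x)) (trans (cong (⊖ a ⊕_) eq) (⊖a⊕[a⊕x]≡x a y))

  ⊕-cancelʳ : ∀ a {x y} → x ⊕ a ≡ y ⊕ a → x ≡ y
  ⊕-cancelʳ a {x} {y} eq = ⊕-cancelˡ a (trans (⊕-comm a x) (trans eq (⊕-comm y a)))

  -- Rotations of values, their cosets, and paths in unions of cosets.

  infixr 7 _▹_

  -- As `∘ₚ` applies its left factor first, the rotation acts on values, whereas the transposition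
  -- in `Swap` acts on positions.
  _▹_ : Fin (suc k) → Permutation′ (suc k) → Permutation′ (suc k)
  a ▹ p = p ∘ₚ permutation (a ⊕_) (⊖ a ⊕_) (a⊕[⊖a⊕x]≡x a) (⊖a⊕[a⊕x]≡x a)

  private
    Perm : Set
    Perm = Permutation′ (suc k)

  clique-adjacent : ∀ (p : Perm) {a b} → a ≢ b → Adjacent (a ▹ p) (b ▹ p)
  clique-adjacent p a≢b x eq = a≢b (⊕-cancelʳ (p ⟨$⟩ʳ x) eq)

  clique-injective : ∀ (p : Perm) {a b} → a ▹ p ≈ b ▹ p → a ≡ b
  clique-injective p eq = ⊕-cancelʳ (p ⟨$⟩ʳ zero) (eq zero)

  DisjointCosets : Perm → Perm → Set
  DisjointCosets p q = ∀ a b → ¬ a ▹ p ≈ b ▹ q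

  -- Evaluating at `zero` forces the two rotations to be equal; cancelling them would give `p ≈ q`.
  sameValue⇒disjointCosets : ∀ (p q : Perm) {v} → p ⟨$⟩ʳ zero ≡ v → q ⟨$⟩ʳ zero ≡ v →
                             ¬ p ≈ q → DisjointCosets p q
  sameValue⇒disjointCosets p q {v} p0 q0 p≉q a b eq = p≉q λ x →
    ⊕-cancelˡ a (trans (eq x) (cong (_⊕ (q ⟨$⟩ʳ x)) (sym a≡b)))
    where
    a≡b : a ≡ b
    a≡b = ⊕-cancelʳ v (trans (cong (a ⊕_) (sym p0)) (trans (eq zero) (cong (b ⊕_) q0)))

  InCosets : List Perm → Perm → Set
  InCosets ps v = Any (λ p → ∃ λ a → v ≈ a ▹ p) ps

  disjoint-cosets : ∀ p {ps} → All (DisjointCosets p) ps → ∀ a v → InCosets ps v → ¬ a ▹ p ≈ v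
  disjoint-cosets p (d ∷ _)  a v (here (b , v≈)) eq = d a b (λ x → trans (eq x) (v≈ x))
  disjoint-cosets p (_ ∷ ds) a v (there v∈)      eq = disjoint-cosets p ds a v v∈ eq

  -- `inside` records which cosets a path may use: paths over disjoint families share no vertex and
  -- can be joined.
  record Path (ps : List Perm) (u v : Perm) (ℓ : ℕ) : Set where
    field
      {rest}   : List Perm
      chain    : Chain Adjacent u v rest
      inside   : All (InCosets ps) (u ∷ rest)
      distinct : AllPairs (λ p q → ¬ p ≈ q) (u ∷ rest)
      size     : length (u ∷ rest) ≡ ℓ

  path-++ : ∀ {ps qs u v w z s t} → Path ps u v s → Adjacent v w → Path qs w z t →
            All (λ p → All (DisjointCosets p) qs) ps → Path (ps ++ qs) u z (s + t)
  path-++ {ps} {u = u} P v~w Q disjoint = record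
    { chain    = chain-++ P.chain v~w Q.chain
    ; inside   = All.++⁺ (All.map Any.++⁺ˡ P.inside) (All.map (Any.++⁺ʳ ps) Q.inside)
    ; distinct = AllPairs.++⁺ P.distinct Q.distinct
                   (All.map (λ {v} v∈ → All.map (λ {w} → distinct v w v∈) Q.inside) P.inside)
    ; size     = trans (length-++ (u ∷ P.rest)) (cong₂ _+_ P.size Q.size)
    }
    where
    module P = Path P
    module Q = Path Q
    distinct : ∀ v w → InCosets ps v → InCosets _ w → ¬ v ≈ w
    distinct v w v∈ w∈ v≈w with All.lookupAny disjoint v∈
    ... | ds , a , v≈ = disjoint-cosets (Any.lookup v∈) ds a w w∈ (λ x → trans (sym (v≈ x)) (v≈w x))

  arc : ∀ {a b : Fin (suc k)} → a ≢ b → ∀ l → suc l < suc k →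
        ∃₂ λ c xs → Chain _≢_ c b xs × Unique (c ∷ xs) × a ∉ c ∷ xs × length xs ≡ l
  arc {b = b} a≢b zero    _ = b , [] , [-] , [] ∷ [] , (λ { (here a≡b) → a≢b a≡b }) , refl
  arc {a}     a≢b (suc l) l<k =
    let c , xs , chain , unique , a∉ , len = arc a≢b l (<-trans (n<1+n (suc l)) l<k)
        d , d∉ = missing (a ∷ c ∷ xs) (subst (λ z → suc (suc z) < suc k) (sym len) l<k)
    in d , c ∷ xs , (λ d≡c → d∉ (there (here d≡c))) ∷ chain , All.¬Any⇒All¬ _ (d∉ ∘ there) ∷ unique
     , (λ { (here a≡d) → d∉ (here (sym a≡d)) ; (there a∈) → a∉ a∈ }) , cong suc len

  clique-distinct : ∀ (p : Perm) {xs} → Unique xs → AllPairs (λ q r → ¬ q ≈ r) (map (_▹ p) xs)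
  clique-distinct p = AllPairs.map⁺ ∘ AllPairs.map (_∘ clique-injective p)

  clique-fresh : ∀ (p : Perm) {a xs} → a ∉ xs → All (λ q → ¬ a ▹ p ≈ q) (map (_▹ p) xs)
  clique-fresh p a∉ = All.map⁺ (All.map (_∘ clique-injective p) (All.¬Any⇒All¬ _ a∉))

  clique-inside : ∀ {p : Perm} {ps} xs → All (InCosets (p ∷ ps)) (map (_▹ p) xs)
  clique-inside xs = All.map⁺ (All.universal (λ a → here (a , λ _ → refl)) xs)

  clique-path : ∀ {p ps} {a b : Fin (suc k)} → a ≢ b → ∀ ℓ → 2 ≤ ℓ → ℓ ≤ suc k →
                Path (p ∷ ps) (a ▹ p) (b ▹ p) ℓ
  clique-path {p} {a = a} a≢b (suc (suc l)) (s≤s (s≤s z≤n)) ℓ≤ with arc a≢b l ℓ≤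
  ... | c , xs , chain , unique , a∉ , refl = record
    { chain    = clique-adjacent p (a∉ ∘ here) ∷ chain-map (clique-adjacent p) chain
    ; inside   = clique-inside (a ∷ c ∷ xs)
    ; distinct = clique-fresh p a∉ ∷ clique-distinct p unique
    ; size     = cong (2 +_) (length-map (_▹ p) xs)
    }

-- Both parts need two vertices, hence `4 ≤ ℓ`. Either the second part gets exactly two, or the
-- first is filled up to `A`.
split-length : ∀ {A B ℓ} → 2 ≤ A → 2 ≤ B → 4 ≤ ℓ → ℓ ≤ A + B →
               ∃₂ λ s t → 2 ≤ s × s ≤ A × 2 ≤ t × t ≤ B × s + t ≡ ℓ
split-length {A} {B} {ℓ} 2≤A 2≤B 4≤ℓ ℓ≤A+B with ℓ ≤? A + 2
... | yes ℓ≤A+2 = ℓ ∸ 2 , 2 , ∸-monoˡ-≤ 2 4≤ℓ , subst (ℓ ∸ 2 ≤_) (m+n∸n≡m A 2) (∸-monoˡ-≤ 2 ℓ≤A+2)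
                , ≤-refl , 2≤B , m∸n+n≡m (≤-trans (s≤s (s≤s z≤n)) 4≤ℓ)
... | no  ℓ≰A+2 = A , ℓ ∸ A , 2≤A , ≤-refl , subst (_≤ ℓ ∸ A) (m+n∸m≡n A 2) (∸-monoˡ-≤ A A+2≤ℓ)
                , subst (ℓ ∸ A ≤_) (m+n∸m≡n A B) (∸-monoˡ-≤ A ℓ≤A+B) , m+[n∸m]≡n (≤-trans (m≤m+n A 2) A+2≤ℓ)
  where
  A+2≤ℓ : A + 2 ≤ ℓ
  A+2≤ℓ = <⇒≤ (≰⇒> ℓ≰A+2)

-- Matchings between cosets and paths of every length, for degree at least four.

module _ {m : ℕ} where

  private
    n : ℕ
    n = 4 + m

    Perm : Set
    Perm = Permutation′ n

    2≤n+ : ∀ {l} → 2 ≤ n + l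
    2≤n+ = s≤s (s≤s z≤n)

  swap-matching : (p q : Perm) → Swap p q → ∃ λ d → ∀ a → Adjacent (a ▹ p) ((a ⊕ d) ▹ q)
  swap-matching p _ (i , j , refl) =
    d , λ a x eq → differs x (⊕-cancelˡ a (trans eq (⊕-assoc a d _)))
    where
    difference : Fin n → Fin n → Fin n
    difference u v = u ⊕ ⊖ v

    -- The shifts that fail at a position fixed by the transposition, at `i`, and at `j`, in this
    -- order.
    excluded : List (Fin n)
    excluded = zero ∷ difference (p ⟨$⟩ʳ i) (p ⟨$⟩ʳ j) ∷ difference (p ⟨$⟩ʳ j) (p ⟨$⟩ʳ i) ∷ []

    d : Fin n
    d = proj₁ (missing excluded (s≤s (s≤s (s≤s (s≤s z≤n)))))

    d∉ : d ∉ excluded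
    d∉ = proj₂ (missing excluded (s≤s (s≤s (s≤s (s≤s z≤n)))))

    solve : ∀ {u v} → u ≡ d ⊕ v → d ≡ difference u v
    solve {u} {v} eq = ⊕-cancelʳ v (trans (sym eq) (sym (x⊕⊖a⊕a≡x v u)))

    differs : ∀ x → p ⟨$⟩ʳ x ≢ d ⊕ (p ⟨$⟩ʳ (transpose i j ⟨$⟩ʳ x))
    differs x eq with transpose-cases i j x
    ... | inj₁ (refl , τx≡j)        =
      d∉ (there (here (solve (trans eq (cong (λ y → d ⊕ (p ⟨$⟩ʳ y)) τx≡j)))))
    ... | inj₂ (inj₁ (refl , τx≡i)) =
      d∉ (there (there (here (solve (trans eq (cong (λ y → d ⊕ (p ⟨$⟩ʳ y)) τx≡i))))))
    ... | inj₂ (inj₂ τx≡x)          =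
      d∉ (here (⊕-cancelʳ (p ⟨$⟩ʳ x) (trans (sym (trans eq (cong (λ y → d ⊕ (p ⟨$⟩ʳ y)) τx≡x))) (sym (⊕-identityˡ _)))))

  cosets-path : ∀ {p q : Perm} {ps} → Chain Swap p q ps → AllPairs DisjointCosets (p ∷ ps) →
                ∀ {a b : Fin n} → a ≢ b → ∀ ℓ → 2 ≤ ℓ → ℓ ≤ length (p ∷ ps) * n →
                Path (p ∷ ps) (a ▹ p) (b ▹ p) ℓ
  cosets-path [-] _ a≢b ℓ 2≤ℓ ℓ≤ = clique-path a≢b ℓ 2≤ℓ (subst (ℓ ≤_) (+-identityʳ n) ℓ≤)
  cosets-path {p} (_∷_ {v = p′} {xs = ps} swap swaps) (disjoint ∷ disjoint′) {a} {b} a≢b ℓ 2≤ℓ ℓ≤ with ℓ ≤? n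
  ... | yes ℓ≤n = clique-path a≢b ℓ 2≤ℓ ℓ≤n
  ... | no  ℓ≰n
    with split-length {n} {length (p′ ∷ ps) * n} (s≤s (s≤s z≤n)) 2≤n+ (≤-trans (m≤m+n 4 m) (<⇒≤ (≰⇒> ℓ≰n))) ℓ≤
  ... | suc (suc l) , t , s≤s (s≤s z≤n) , s≤n , 2≤t , t≤ , refl with arc a≢b l s≤n
  -- The first clique contributes `l + 2` vertices: `a` and the arc from `c` to `b`. The matching is
  -- crossed forwards at `a` and backwards at `c`.
  ... | c , xs , chain , unique , a∉ , refl = record
    { chain    = matching a ∷ chain-++ P.chain (λ x → matching c x ∘ sym) (chain-map (clique-adjacent p) chain)
    ; inside   = here (a , λ _ → refl) ∷ All.++⁺ (All.map there P.inside) (clique-inside (c ∷ xs))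
    ; distinct = All.++⁺ (All.map (λ {v} → disjoint-cosets p disjoint a v) P.inside) (clique-fresh p a∉)
               ∷ AllPairs.++⁺ P.distinct (clique-distinct p unique)
                   (All.map (λ {v} v∈ → All.map⁺ (All.universal
                     (λ a′ v≈ → disjoint-cosets p disjoint a′ v v∈ (λ x → sym (v≈ x))) (c ∷ xs))) P.inside)
    ; size     = cong suc (begin
        length (start ++ map (_▹ p) (c ∷ xs))          ≡⟨ length-++ start ⟩
        length start + length (map (_▹ p) (c ∷ xs))    ≡⟨ cong₂ _+_ P.size (length-map (_▹ p) (c ∷ xs)) ⟩
        t + suc (length xs)                            ≡⟨ +-comm t _ ⟩
        suc (length xs) + t                            ∎)
    }
    where
    open ≡-Reasoning
    d : Fin n
    d = proj₁ (swap-matching p p′ swap)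

    matching : ∀ a → Adjacent (a ▹ p) ((a ⊕ d) ▹ p′)
    matching = proj₂ (swap-matching p p′ swap)

    P : Path (p′ ∷ ps) ((a ⊕ d) ▹ p′) ((c ⊕ d) ▹ p′) t
    P = cosets-path swaps disjoint′ (a∉ ∘ here ∘ ⊕-cancelʳ d) t 2≤t t≤

    module P = Path P

    start : List Perm
    start = (a ⊕ d) ▹ p′ ∷ P.rest

  -- Common neighbours and triangles.

  Avoids : Perm → Perm → Perm → Fin n → Set
  Avoids g h k x = k ⟨$⟩ʳ x ≢ g ⟨$⟩ʳ x × k ⟨$⟩ʳ x ≢ h ⟨$⟩ʳ x

  -- Exchanging the values of k at x and z creates a conflict only if k z ∈ {g x , h x}
  -- or k x ∈ {g z , h z}; as k x ≡ g x, two of these four exceptions are z ≡ x.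
  repair : ∀ g h k x → k ⟨$⟩ʳ x ≡ g ⟨$⟩ʳ x →
           ∃ λ k′ → Avoids g h k′ x × (∀ {y} → Avoids g h k y → Avoids g h k′ y)
  repair g h k x kx≡gx = k′ , k′x , λ {y} → k′y {y}
    where
    excluded : List (Fin n)
    excluded = x ∷ (k ⟨$⟩ˡ (h ⟨$⟩ʳ x)) ∷ (h ⟨$⟩ˡ (k ⟨$⟩ʳ x)) ∷ []

    z : Fin n
    z = proj₁ (missing excluded (s≤s (s≤s (s≤s (s≤s z≤n)))))

    z∉ : z ∉ excluded
    z∉ = proj₂ (missing excluded (s≤s (s≤s (s≤s (s≤s z≤n)))))

    k′ : Perm
    k′ = transpose x z ∘ₚ k

    k′x : Avoids g h k′ x
    k′x rewrite transpose-matchˡ x z =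
      (λ eq → z∉ (here (⟨$⟩ʳ-injective k (trans eq (sym kx≡gx))))) , z∉ ∘ there ∘ here ∘ ⟨$⟩ʳ⇒⟨$⟩ˡ k

    k′y : ∀ {y} → Avoids g h k y → Avoids g h k′ y
    k′y {y} avoids with transpose-cases x z y
    ... | inj₁ (refl , _)           = k′x
    ... | inj₂ (inj₁ (refl , τy≡x)) rewrite τy≡x =
      (λ eq → z∉ (here (⟨$⟩ʳ-injective g (trans (sym eq) kx≡gx)))) ,
      (λ eq → z∉ (there (there (here (⟨$⟩ʳ⇒⟨$⟩ˡ h (sym eq))))))
    ... | inj₂ (inj₂ τy≡y)          rewrite τy≡y = avoids

  avoiding : ∀ g h xs → ∃ λ k → All (Avoids g h k) xs
  -- The starting permutation is arbitrary; each position is repaired when it is reached, without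
  -- spoiling the earlier ones.
  avoiding g h []       = g , []
  avoiding g h (x ∷ xs) with avoiding g h xs
  ... | k , good with k ⟨$⟩ʳ x ≟ g ⟨$⟩ʳ x | k ⟨$⟩ʳ x ≟ h ⟨$⟩ʳ x
  ... | yes eq | _      = let k′ , now , keep = repair g h k x eq in k′ , now ∷ All.map keep good
  -- A conflict with `h` is repaired with the roles of `g` and `h` exchanged.
  ... | no  _  | yes eq =
    let k′ , now , keep = repair h g k x eq
    in k′ , swap now ∷ All.map (λ av → swap (keep (swap av))) good
  ... | no ≢g  | no ≢h  = k , (≢g , ≢h) ∷ good

  commonNeighbour : ∀ g h → ∃ λ (k : Perm) → Adjacent g k × Adjacent k h
  commonNeighbour g h =
    let k , good = avoiding g h (allFin n)
    in k , (λ x eq → proj₁ (All.lookup good (∈-allFin x)) (sym eq)) , (λ x → proj₂ (All.lookup good (∈-allFin x)))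

  triangle : ∀ (g h : Perm) → Adjacent g h → Σ (Cycle n 3) (λ C → ContainsEdge C g h)
  triangle g h g~h =
    let k , g~k , k~h = commonNeighbour g h
    in cycle-of-chain g h {g} {h} {k ∷ h ∷ []} g~h (λ _ → refl) (λ _ → refl) (g~k ∷ k~h ∷ [-])
         (((λ eq → g~k zero (eq zero)) ∷ (λ eq → g~h zero (eq zero)) ∷ [])
          ∷ ((λ eq → k~h zero (eq zero)) ∷ []) ∷ [] ∷ []) refl

  -- Cycles through a given edge.

  0▹g≈g : ∀ (g : Perm) → zero ▹ g ≈ g
  0▹g≈g g x = ⊕-identityˡ (g ⟨$⟩ʳ x)

  cycle-of-path : ∀ (g h : Perm) → Adjacent g h → ∀ d r → d ▹ r ≈ h →
                  ∀ {ps ℓ} → Path ps (zero ▹ g) (d ▹ r) ℓ → Σ (Cycle n ℓ) (λ C → ContainsEdge C g h)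
  cycle-of-path g h g~h d r d▹r≈h P =
    cycle-of-chain g h {zero ▹ g} {d ▹ r} g~h (0▹g≈g g) d▹r≈h P.chain P.distinct P.size
    where module P = Path P

  edge-on-cycle : ∀ (g h : Perm) → Adjacent g h → ∀ {q ps} → Chain Swap g q ps →
                  AllPairs DisjointCosets (g ∷ ps) → ∀ d → Any (λ r → d ▹ r ≈ h) (g ∷ ps) →
                  ∀ ℓ → 3 ≤ ℓ → ℓ ≤ length (g ∷ ps) * n → Σ (Cycle n ℓ) (λ C → ContainsEdge C g h)
  edge-on-cycle g h g~h chain disjoint d (here d▹g≈h) ℓ 3≤ℓ ℓ≤ =
    cycle-of-path g h g~h d g d▹g≈h (cosets-path chain disjoint 0≢d ℓ (<⇒≤ 3≤ℓ) ℓ≤)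
    where
    -- With `d` zero, `g` and `h` would coincide, but they are adjacent.
    0≢d : zero ≢ d
    0≢d 0≡d = g~h zero (trans (sym (0▹g≈g g zero)) (trans (cong (_⊕ (g ⟨$⟩ʳ zero)) 0≡d) (d▹g≈h zero)))
  edge-on-cycle g h g~h chain disjoint d (there h∈) ℓ 3≤ℓ ℓ≤ with m≤n⇒m<n∨m≡n 3≤ℓ
  ... | inj₂ refl = triangle g h g~h
  ... | inj₁ 4≤ℓ  with chain-split chain h∈
  ... | record { start = r ; before = before ; after = after ; beforeChain = c₁ ; afterChain = c₂
               ; start-P = d▹r≈h ; ++-eq = refl }
    with AllPairs-++⁻ (g ∷ before) disjoint
       | split-length {length (g ∷ before) * n} {length (r ∷ after) * n} 2≤n+ 2≤n+ 4≤ℓ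
           (subst (ℓ ≤_) (trans (cong (_* n) (length-++ (g ∷ before))) (*-distribʳ-+ n (length (g ∷ before)) _)) ℓ≤)
  ... | disjoint₁ , disjoint₂ , across | s , t , 2≤s , s≤ , 2≤t , t≤ , refl =
    cycle-of-path g h g~h d r d▹r≈h
      (path-++ (cosets-path c₁ disjoint₁ 0≢1 s 2≤s s≤) 1▹g~1⊕d▹r
               (cosets-path c₂ disjoint₂ 1⊕d≢d t 2≤t t≤) across)
    where
    1F : Fin n
    1F = suc zero

    0≢1 : zero ≢ 1F
    0≢1 ()

    1⊕d≢d : 1F ⊕ d ≢ d
    1⊕d≢d eq = 0≢1 (⊕-cancelʳ d (trans (⊕-identityˡ d) (sym eq)))

    -- The right-hand vertex is `1F ▹ h` up to `≈`, and rotating both ends of an edge by the same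
    -- amount preserves adjacency.
    1▹g~1⊕d▹r : Adjacent (1F ▹ g) ((1F ⊕ d) ▹ r)
    1▹g~1⊕d▹r x eq = g~h x (⊕-cancelˡ 1F
      (trans eq (trans (⊕-assoc 1F d _) (cong (1F ⊕_) (d▹r≈h x)))))

  edge-pancyclic : ∀ (g h : Perm) → Adjacent g h → ∀ ℓ → 3 ≤ ℓ → ℓ ≤ n ! →
                   Σ (Cycle n ℓ) (λ C → ContainsEdge C g h)
  edge-pancyclic g h g~h ℓ 3≤ℓ ℓ≤n! = fromEnumeration (enumerate positive (Unique.tabulate⁺ suc-injective) g)
    where
    -- Permuting only these positions keeps the value of `g` at `zero`, which selects one
    -- representative from each coset.
    positive : List (Fin n)
    positive = tabulate suc

    zero∉ : zero ∉ positive
    zero∉ 0∈ with ∈-tabulate⁻ {f = Fin.suc} 0∈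
    ... | _ , ()

    -- The rotation for which `h′`, in the coset of `h`, has the same value at `zero` as `g` and so
    -- occurs in the listing.
    d : Fin n
    d = (h ⟨$⟩ʳ zero) ⊕ ⊖ (g ⟨$⟩ʳ zero)

    h′ : Perm
    h′ = ⊖ d ▹ h

    h0≡d⊕g0 : h ⟨$⟩ʳ zero ≡ d ⊕ (g ⟨$⟩ʳ zero)
    h0≡d⊕g0 = sym (x⊕⊖a⊕a≡x (g ⟨$⟩ʳ zero) (h ⟨$⟩ʳ zero))

    g~h′ : AgreeOff positive g h′
    g~h′ zero    _  = sym (trans (cong (⊖ d ⊕_) h0≡d⊕g0) (⊖a⊕[a⊕x]≡x d _))
    g~h′ (suc i) i∉ = contradiction (∈-tabulate⁺ {f = Fin.suc} i) i∉

    cosets-disjoint : ∀ {ps} → All (AgreeOff positive g) ps → AllPairs (λ p q → ¬ p ≈ q) ps →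
                      AllPairs DisjointCosets ps
    cosets-disjoint                []         []         = []
    cosets-disjoint {ps = p ∷ ps}  (ag ∷ ags) (p≉ ∷ ps!) =
      All.zipWith (λ {q} (ag′ , p≉q) →
        sameValue⇒disjointCosets p q (sym (ag zero zero∉)) (sym (ag′ zero zero∉)) p≉q) (ags , p≉)
      ∷ cosets-disjoint ags ps!

    fromEnumeration : Enumeration (AgreeOff positive g) g (length positive !) →
                      Σ (Cycle n ℓ) (λ C → ContainsEdge C g h)
    fromEnumeration E = edge-on-cycle g h g~h chain (cosets-disjoint sound distinct) d
      (Any.map (λ {r} h′≈r x → trans (cong (d ⊕_) (sym (h′≈r x))) (a⊕[⊖a⊕x]≡x d _)) (complete h′ g~h′))
      ℓ 3≤ℓ (subst (ℓ ≤_) (begin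
        n * (3 + m) !            ≡⟨ *-comm n ((3 + m) !) ⟩
        (3 + m) ! * n            ≡⟨ cong (λ l → l ! * n) (length-tabulate {n = 3 + m} Fin.suc) ⟨
        length positive ! * n    ≡⟨ cong (_* n) count ⟨
        length (g ∷ rest) * n    ∎) ℓ≤n!)
      where
      open Enumeration E
      open ≡-Reasoning

theorem1 : (n : ℕ) → 4 ≤ n →
    (g h : Permutation′ n) → Adjacent g h →
    (ℓ : ℕ) → 3 ≤ ℓ → ℓ ≤ n ! →
    Σ (Cycle n ℓ) (λ C → ContainsEdge C g h)
theorem1 (suc (suc (suc (suc m)))) (s≤s (s≤s (s≤s (s≤s z≤n)))) = edge-pancyclic
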